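{- Let $G$ be an esp-digraph. Then $\chi_o(G)\le 7$.
   Context: An oriented graph is a digraph without loops and without pairs of opposite arcs. For a digraph $G=(V,E)$ (parallel arcs allowed; the definitions apply verbatim), an oriented $r$-vertex-coloring is a map $c:V\to\{1,\dots,r\}$ such that (i) $c(u)\ne c(v)$ for every arc $(u,v)\in E$, and (ii) $c(u)\ne c(y)$ for every two arcs $(u,v),(x,y)\in E$ with $c(v)=c(x)$. Equivalently, $c$ is a homomorphism to an oriented graph on $r$ vertices. The oriented chromatic number $\chi_o(G)$ is the smallest $r$ for which such a coloring exists. Edge series-parallel (multi)digraphs (esp-digraphs) are defined recursively, each with a distinguished source and sink: (i) a digraph with two distinct vertices $u,v$ and the single arc $(u,v)$ is an esp-digraph with source $u$ and sink $v$; (ii) if $G_1,G_2$ are vertex-disjoint esp-digraphs, then the parallel composition $G_1\cup G_2$ (identify the source of $G_1$ with the source of $G_2$ and the sink of $G_1$ with the sink of $G_2$; arcs are united, possibly creating parallel arcs) is an esp-digraph with these identified source and sink, and the series composition $G_1\times G_2$ (identify the sink of $G_1$ with the source of $G_2$) is an esp-digraph with source the source of $G_1$ and sink the sink of $G_2$. -}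

module Defs where

open import Data.Fin using (Fin)
open import Data.Nat using (ℕ; _≤_)
open import Data.Product using (∃; _×_)
open import Data.Sum using (_⊎_; inj₁; inj₂)
open import Function.Bundles using (_↔_; _⇔_; Inverse)
open import Function.Definitions using (Injective)
open import Relation.Binary.PropositionalEquality using (_≡_; _≢_)

-- Arcs are named rather than being pairs of vertices, so that parallel arcs
-- are allowed.
record Digraph : Set where
  field
    #vertices : ℕ
    #arcs     : ℕ

  Vertex : Set
  Vertex = Fin #vertices

  Arc : Set
  Arc = Fin #arcs

  field
    tail : Arc → Vertex
    head : Arc → Vertex

open Digraph public

record IsOrientedColoring (G : Digraph) (r : ℕ) (c : Vertex G → Fin r) : Set where
  field
    proper   : ∀ e → c (tail G e) ≢ c (head G e)
    oriented : ∀ e f → c (head G e) ≡ c (tail G f) → c (tail G e) ≢ c (head G f)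

OrientedColorable : Digraph → ℕ → Set
OrientedColorable G r = ∃ λ (c : Vertex G → Fin r) → IsOrientedColoring G r c

-- A relation, because a digraph with a loop or a pair of opposite arcs
-- has no oriented coloring at all.
record IsOrientedChromaticNumber (G : Digraph) (r : ℕ) : Set where
  field
    colorable : OrientedColorable G r
    smallest  : ∀ k → OrientedColorable G k → r ≤ k

-- Gluing G₁ G₂ _~_ G exhibits G as the digraph obtained from disjoint copies
-- of G₁ and G₂ by identifying x in G₁ with y in G₂ exactly when x ~ y, and
-- making no other identification; the arcs of G are the disjoint union of the
-- arcs of G₁ and G₂. This determines G up to isomorphism.
record Gluing (G₁ G₂ : Digraph) (_~_ : Vertex G₁ → Vertex G₂ → Set) (G : Digraph) : Set where
  field
    ι₁ : Vertex G₁ → Vertex G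
    ι₂ : Vertex G₂ → Vertex G
    ι₁-injective : Injective _≡_ _≡_ ι₁
    ι₂-injective : Injective _≡_ _≡_ ι₂
    identified   : ∀ x y → ι₁ x ≡ ι₂ y ⇔ x ~ y
    covered      : ∀ v → (∃ λ x → ι₁ x ≡ v) ⊎ (∃ λ y → ι₂ y ≡ v)

    arcs : (Arc G₁ ⊎ Arc G₂) ↔ Arc G

  open Inverse arcs using (to)

  field
    tail₁ : ∀ e → tail G (to (inj₁ e)) ≡ ι₁ (tail G₁ e)
    head₁ : ∀ e → head G (to (inj₁ e)) ≡ ι₁ (head G₁ e)
    tail₂ : ∀ e → tail G (to (inj₂ e)) ≡ ι₂ (tail G₂ e)
    head₂ : ∀ e → head G (to (inj₂ e)) ≡ ι₂ (head G₂ e)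

record SingleArc (G : Digraph) (u v : Vertex G) : Set where
  field
    distinct    : u ≢ v
    vertices    : ∀ w → w ≡ u ⊎ w ≡ v
    arc         : Arc G
    arc-unique  : ∀ e → e ≡ arc
    tail-arc    : tail G arc ≡ u
    head-arc    : head G arc ≡ v

ParallelComposition : (G₁ : Digraph) (s₁ t₁ : Vertex G₁) (G₂ : Digraph) (s₂ t₂ : Vertex G₂) → Digraph → Set
ParallelComposition G₁ s₁ t₁ G₂ s₂ t₂ =
  Gluing G₁ G₂ (λ x y → (x ≡ s₁ × y ≡ s₂) ⊎ (x ≡ t₁ × y ≡ t₂))

SeriesComposition : (G₁ : Digraph) (t₁ : Vertex G₁) (G₂ : Digraph) (s₂ : Vertex G₂) → Digraph → Set
SeriesComposition G₁ t₁ G₂ s₂ = Gluing G₁ G₂ (λ x y → x ≡ t₁ × y ≡ s₂)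

-- IsEsp G s t: G is an edge series-parallel multidigraph with source s and sink t.
data IsEsp : (G : Digraph) → Vertex G → Vertex G → Set where
  single : ∀ {G u v} → SingleArc G u v → IsEsp G u v

  parallel : ∀ {G₁ s₁ t₁ G₂ s₂ t₂ G} →
             IsEsp G₁ s₁ t₁ → IsEsp G₂ s₂ t₂ →
             (g : ParallelComposition G₁ s₁ t₁ G₂ s₂ t₂ G) →
             IsEsp G (Gluing.ι₁ g s₁) (Gluing.ι₁ g t₁)

  series : ∀ {G₁ s₁ t₁ G₂ s₂ t₂ G} →
           IsEsp G₁ s₁ t₁ → IsEsp G₂ s₂ t₂ →
           (g : SeriesComposition G₁ t₁ G₂ s₂ G) →
           IsEsp G (Gluing.ι₁ g s₁) (Gluing.ι₂ g t₂)

{-# OPTIONS --safe #-}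
-- The Paley tournament on ℤ/7 (a → b iff b − a is a nonzero square) joins the
-- ends of each of its arcs by a directed path of length two as well. So, by
-- induction on the decomposition, each of its arcs a → b extends to a
-- homomorphism from the esp-digraph sending the source to a and the sink to b:
-- a parallel composition reuses a → b on both parts, a series composition uses
-- a → m and m → b.
module Submission where

open import Data.Nat using (_≤_)
open import Data.Product using (∃; _×_)
open import Defs

open import Data.Fin using (Fin; #_; toℕ; finToFun; funToFin)
open import Data.Fin.Properties using (_≟_; all?; any?; finToFun-funToFin)
open import Data.Nat using (ℕ; zero; suc; _+_; z≤n; s≤s)
open import Data.Nat.DivMod using (_%_)
open import Data.Product using (_,_)
open import Data.Sum using (_⊎_; inj₁; inj₂)
open import Function using (_∘_; Equivalence; Inverse)
open import Level using (Level)
open import Relation.Binary.PropositionalEquality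
open import Relation.Nullary using (¬_; Dec; yes; no; contradiction)
open import Relation.Nullary.Decidable using (map′; from-yes; ¬?; _×-dec_; _→-dec_; _⊎-dec_)
open import Relation.Unary using (Pred; Decidable)
import Data.Nat.Properties as ℕ

private
  variable
    p : Level
    r : ℕ
    G G₁ G₂ : Digraph

infix 4 _⟶_ _⟶?_

-- Subtraction-free form of b − a ∈ {1, 2, 4}.
_⟶_ : Fin 7 → Fin 7 → Set
a ⟶ b = toℕ b ≡ (toℕ a + 1) % 7 ⊎ toℕ b ≡ (toℕ a + 2) % 7 ⊎ toℕ b ≡ (toℕ a + 4) % 7

_⟶?_ : ∀ a b → Dec (a ⟶ b)
a ⟶? b = (toℕ b ℕ.≟ _) ⊎-dec (toℕ b ℕ.≟ _) ⊎-dec (toℕ b ℕ.≟ _)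

⟶-irrefl : ∀ a → ¬ (a ⟶ a)
⟶-irrefl = from-yes (all? λ a → ¬? (a ⟶? a))

-- -1 is not a square mod 7, so a difference and its negative are never both nonzero squares.
⟶-asym : ∀ a b → a ⟶ b → ¬ (b ⟶ a)
⟶-asym = from-yes (all? λ a → all? λ b → (a ⟶? b) →-dec ¬? (b ⟶? a))

-- Mod 7, 1 = 4 + 4, 2 = 1 + 1 and 4 = 2 + 2: half of a nonzero square is again one, so the midpoint
-- of `a` and `b` serves as `m`.
⟶-dense : ∀ a b → a ⟶ b → ∃ λ m → a ⟶ m × m ⟶ b
⟶-dense = from-yes (all? λ a → all? λ b → (a ⟶? b) →-dec any? λ m → (a ⟶? m) ×-dec (m ⟶? b))

IsHomomorphism : (G : Digraph) → (Vertex G → Fin 7) → Set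
IsHomomorphism G c = ∀ e → c (tail G e) ⟶ c (head G e)

-- A violation of `proper` would be a loop in the tournament, and a violation of `oriented` a pair
-- of opposite arcs.
homomorphism⇒coloring : ∀ {c} → IsHomomorphism G c → IsOrientedColoring G 7 c
homomorphism⇒coloring {G} {c} hom = record
  { proper   = λ e eq → ⟶-irrefl (c (tail G e)) (subst (c (tail G e) ⟶_) (sym eq) (hom e))
  ; oriented = λ e f h≡t t≡h →
      ⟶-asym (c (tail G e)) (c (head G e)) (hom e) (subst₂ _⟶_ (sym h≡t) (sym t≡h) (hom f))
  }

module _ {_~_ : Vertex G₁ → Vertex G₂ → Set} (g : Gluing G₁ G₂ _~_ G)
         {c₁ : Vertex G₁ → Fin 7} {c₂ : Vertex G₂ → Fin 7}
         (agree : ∀ {x y} → x ~ y → c₁ x ≡ c₂ y) where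
  open Gluing g

  -- On an identified vertex `covered` may report either part; `agree` makes that choice immaterial,
  -- which is what `glue-ι₁` and `glue-ι₂` record.
  glue : Vertex G → Fin 7
  glue v with covered v
  ... | inj₁ (x , _) = c₁ x
  ... | inj₂ (y , _) = c₂ y

  glue-ι₁ : ∀ x → glue (ι₁ x) ≡ c₁ x
  glue-ι₁ x with covered (ι₁ x)
  ... | inj₁ (x′ , eq) = cong c₁ (ι₁-injective eq)
  ... | inj₂ (y , eq)  = sym (agree (Equivalence.to (identified x y) (sym eq)))

  glue-ι₂ : ∀ y → glue (ι₂ y) ≡ c₂ y
  glue-ι₂ y with covered (ι₂ y)
  ... | inj₁ (x , eq)  = agree (Equivalence.to (identified x y) eq)
  ... | inj₂ (y′ , eq) = cong c₂ (ι₂-injective eq)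

  glue-homomorphism : IsHomomorphism G₁ c₁ → IsHomomorphism G₂ c₂ → IsHomomorphism G glue
  glue-homomorphism hom₁ hom₂ e =
    -- Each arc of `G` is the image of an arc of one part, so it suffices to check such images.
    subst (λ e → glue (tail G e) ⟶ glue (head G e)) (Inverse.strictlyInverseˡ arcs e) (onArc (Inverse.from arcs e))
    where
    onArc : ∀ e → glue (tail G (Inverse.to arcs e)) ⟶ glue (head G (Inverse.to arcs e))
    onArc (inj₁ e) rewrite tail₁ e | head₁ e | glue-ι₁ (tail G₁ e) | glue-ι₁ (head G₁ e) = hom₁ e
    onArc (inj₂ e) rewrite tail₂ e | head₂ e | glue-ι₂ (tail G₂ e) | glue-ι₂ (head G₂ e) = hom₂ e

esp-homomorphism : ∀ {s t} → IsEsp G s t → ∀ a b → a ⟶ b →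
                   ∃ λ c → IsHomomorphism G c × c s ≡ a × c t ≡ b
esp-homomorphism {G} {s} {t} (single arc) a b a⟶b = c , hom , c-source , c-sink
  where
  open SingleArc arc renaming (arc to e₀)

  c : Vertex G → Fin 7
  c w with w ≟ s
  ... | yes _ = a
  ... | no _  = b

  c-source : c s ≡ a
  c-source with s ≟ s
  ... | yes _  = refl
  ... | no s≢s = contradiction refl s≢s

  c-sink : c t ≡ b
  c-sink with t ≟ s
  ... | yes t≡s = contradiction (sym t≡s) distinct
  ... | no _    = refl

  hom : IsHomomorphism G c
  hom e rewrite arc-unique e | tail-arc | head-arc | c-source | c-sink = a⟶b
esp-homomorphism (parallel {s₁ = s₁} {t₁} {s₂ = s₂} {t₂} esp₁ esp₂ g) a b a⟶b
  with c₁ , hom₁ , refl , refl ← esp-homomorphism esp₁ a b a⟶b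
  with c₂ , hom₂ , s-eq , t-eq ← esp-homomorphism esp₂ a b a⟶b
  = glue g agree , glue-homomorphism g agree hom₁ hom₂ , glue-ι₁ g agree s₁ , glue-ι₁ g agree t₁
  where
  agree : ∀ {x y} → (x ≡ s₁ × y ≡ s₂) ⊎ (x ≡ t₁ × y ≡ t₂) → c₁ x ≡ c₂ y
  agree (inj₁ (refl , refl)) = sym s-eq
  agree (inj₂ (refl , refl)) = sym t-eq
esp-homomorphism (series {s₁ = s₁} {t₁} {s₂ = s₂} {t₂} esp₁ esp₂ g) a b a⟶b
  with m , a⟶m , m⟶b ← ⟶-dense a b a⟶b
  -- Both parts give the shared vertex the color `m`, which is why the two colorings can be glued
  -- there.
  with c₁ , hom₁ , refl , refl ← esp-homomorphism esp₁ a m a⟶m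
  with c₂ , hom₂ , s-eq , refl ← esp-homomorphism esp₂ m b m⟶b
  = glue g agree , glue-homomorphism g agree hom₁ hom₂ , glue-ι₁ g agree s₁ , glue-ι₂ g agree t₂
  where
  agree : ∀ {x y} → x ≡ t₁ × y ≡ s₂ → c₁ x ≡ c₂ y
  agree (refl , refl) = sym s-eq

isOrientedColoring? : ∀ G (c : Vertex G → Fin r) → Dec (IsOrientedColoring G r c)
isOrientedColoring? G c =
  map′ (λ (p , o) → record { proper = p ; oriented = o }) (λ col → proper col , oriented col)
    ((all? λ e → ¬? (c (tail G e) ≟ c (head G e))) ×-dec
     (all? λ e → all? λ f → (c (head G e) ≟ c (tail G f)) →-dec ¬? (c (tail G e) ≟ c (head G f))))
  where open IsOrientedColoring

-- Needed because encoding a map as a number and decoding it gives back the map only pointwise.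
isOrientedColoring-resp-≗ : ∀ {c d : Vertex G → Fin r} → c ≗ d →
                            IsOrientedColoring G r c → IsOrientedColoring G r d
isOrientedColoring-resp-≗ c≗d col = record
  { proper   = λ e eq → proper e (trans (c≗d _) (trans eq (sym (c≗d _))))
  ; oriented = λ e f h≡t t≡h → oriented e f (trans (c≗d _) (trans h≡t (sym (c≗d _))))
                                            (trans (c≗d _) (trans t≡h (sym (c≗d _))))
  }
  where open IsOrientedColoring col

-- There are finitely many maps into `Fin r`, coded by `funToFin`, so exhaustive search decides.
-- This lets the least number of colors be found constructively.
orientedColorable? : ∀ G → Decidable (OrientedColorable G)
orientedColorable? G r =
  map′ (λ (i , col) → finToFun i , col)
       (λ (c , col) → funToFin c , isOrientedColoring-resp-≗ (sym ∘ finToFun-funToFin c) col)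
       (any? (isOrientedColoring? G ∘ finToFun))

-- Search upwards from zero, shifting the predicate by `suc` after each failure; the known witness
-- `n` bounds the search and hence the result.
least : ∀ {P : Pred ℕ p} → Decidable P → ∀ n → P n →
        ∃ λ m → P m × (∀ k → P k → m ≤ k) × m ≤ n
least P? zero Pn = zero , Pn , (λ _ _ → z≤n) , z≤n
least {P = P} P? (suc n) Pn with P? zero
... | yes P0 = zero , P0 , (λ _ _ → z≤n) , z≤n
... | no ¬P0 with m , Pm , minimal , m≤n ← least (P? ∘ suc) n Pn = suc m , Pm , minimal⁺ , s≤s m≤n
  where
  minimal⁺ : ∀ k → P k → suc m ≤ k
  minimal⁺ zero    P0 = contradiction P0 ¬P0
  minimal⁺ (suc k) Pk = s≤s (minimal k Pk)

theorem3 : (G : Digraph) (s t : Vertex G) → IsEsp G s t →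
    ∃ λ χ → IsOrientedChromaticNumber G χ × χ ≤ 7
theorem3 G s t esp
  -- Any arc of the tournament would do for the ends; 0 → 1 has difference 1, a square.
  with c , hom , _ ← esp-homomorphism esp (# 0) (# 1) (inj₁ refl)
  with χ , colorable , smallest , χ≤7 ← least (orientedColorable? G) 7 (c , homomorphism⇒coloring hom)
  = χ , record { colorable = colorable ; smallest = smallest } , χ≤7
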